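{- Let $k \ge 2$, $\rho \ge 1$ and $v$ be integers (for which $\beta(\rho,v,k)$ is defined). Then \[ \beta(\rho,v,k) \le \rho\left( \frac{k^2(\rho-1)}{2} + 1 + \max\left\{ k(k-1), \left\lfloor \frac{v-k\rho}{k-1} \right\rfloor \right\} \right). \]
   Context: For integers $v \ge k \ge 2$, a $(v,k)$-packing is a pair $(X,\mathcal{B})$ where $X$ is a set of $v$ points and $\mathcal{B}$ is a set of $k$-subsets of $X$ (blocks) such that every pair of distinct points lies in at most one block. A partial parallel class (PPC) is a set of pairwise disjoint blocks; its size is the number of blocks. A PPC of size $\rho$ is maximum if the packing has no PPC of size $\rho+1$. $\beta(\rho,v,k)$ denotes the maximum number of blocks in a $(v,k)$-packing in which the maximum PPC has size $\rho$. -}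

module Defs where

open import Data.Nat.Base as ℕ using (ℕ; suc; NonZero; s≤s)
open import Data.Integer.Base as ℤ using (ℤ; +_)
import Data.Integer.DivMod as ℤDivMod
open import Data.Rational.Base as ℚ using (ℚ)
open import Data.Fin.Base using (Fin)
open import Data.Fin.Subset using (Subset; _∈_; _∩_; ∣_∣; Empty)
open import Data.List.Base using (List; length)
open import Data.List.Relation.Unary.All using (All)
open import Data.List.Relation.Unary.AllPairs using (AllPairs)
open import Data.List.Relation.Unary.Unique.Propositional using (Unique)
import Data.List.Membership.Propositional as List
open import Data.Product.Base using (∃-syntax; _×_)
open import Relation.Nullary.Negation.Core using (¬_)
open import Relation.Binary.PropositionalEquality.Core using (_≡_; _≢_)

-- The point set is Fin v.  Finite sets of blocks are duplicate-free lists,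
-- so that their cardinality is the length of the list.

record Packing (v k : ℕ) : Set where
  field
    blocks  : List (Subset v)
    unique  : Unique blocks
    uniform : ∀ {B} → B List.∈ blocks → ∣ B ∣ ≡ k
    packing : ∀ {x y : Fin v} → x ≢ y →
              ∀ {A B} → A List.∈ blocks → B List.∈ blocks →
              x ∈ A → y ∈ A → x ∈ B → y ∈ B → A ≡ B

open Packing public using (blocks)

#blocks : ∀ {v k} → Packing v k → ℕ
#blocks D = length (blocks D)

record IsPPC {v k} (D : Packing v k) (P : List (Subset v)) : Set where
  field
    unique   : Unique P
    isBlock  : All (List._∈ blocks D) P
    disjoint : AllPairs (λ A B → Empty (A ∩ B)) P

HasPPC : ∀ {v k} → Packing v k → ℕ → Set
HasPPC D n = ∃[ P ] IsPPC D P × length P ≡ n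

MaxPPCSize : ∀ {v k} → Packing v k → ℕ → Set
MaxPPCSize D ρ = HasPPC D ρ × ¬ HasPPC D (suc ρ)

-- β(ρ,v,k) is a partial function (there may be no packing whose maximum PPC
-- has size ρ), given here by its graph: IsBeta ρ v k b says that β(ρ,v,k) is
-- defined and equal to b.

record IsBeta (ρ v k b : ℕ) : Set where
  field
    attained : ∃[ D ] MaxPPCSize {v} {k} D ρ × #blocks D ≡ b
    maximal  : ∀ (D : Packing v k) → MaxPPCSize D ρ → #blocks D ℕ.≤ b

k∸1-nonZero : ∀ {k} → 2 ℕ.≤ k → NonZero (k ℕ.∸ 1)
k∸1-nonZero (s≤s (s≤s _)) = _

-- The difference v - kρ is taken in ℤ, and _/ℕ_ rounds towards -∞.  The
-- truncated differences k ∸ 1 and ρ ∸ 1 are exact for k ≥ 2 and ρ ≥ 1.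

⌊[v-kρ]/[k-1]⌋ : (ρ v k : ℕ) → 2 ℕ.≤ k → ℤ
⌊[v-kρ]/[k-1]⌋ ρ v k 2≤k =
  ℤDivMod._/ℕ_ (+ v ℤ.- + (k ℕ.* ρ)) (k ℕ.∸ 1) ⦃ k∸1-nonZero 2≤k ⦄

fromℕ : ℕ → ℚ
fromℕ n = + n ℚ./ 1

fromℤ : ℤ → ℚ
fromℤ i = i ℚ./ 1

{-# OPTIONS --safe #-}
module Submission where

-- Fix a maximum PPC P.  By maximality every block meets a member of P.  A block
-- outside P that meets two members contains a pair of points from different
-- members; there are k²ρ(ρ-1)/2 such pairs, each in at most one block.  The
-- other blocks outside P meet a single C in P, in a single point.  Two of them
-- that meet C in different points intersect, for otherwise they could replace C
-- in P.  Hence if all blocks private to C pass through one point, they use up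
-- k - 1 fresh points each, so there are at most (v-kρ)/(k-1) of them.  If not,
-- those through a given x in C all meet a private block E through another point
-- of C, in distinct points of E outside C: at most k - 1 blocks for each x.

open import Data.Nat.Base as ℕ using (ℕ; zero; suc; z≤n)
import Data.Nat.Properties as ℕ
open import Data.Nat.ListAction using (sum)
open import Data.Nat.ListAction.Properties using (sum-++)
open import Data.Nat.Tactic.RingSolver using (solve-∀)
open import Data.Nat.DivMod using (m*n/n≡m; /-monoˡ-≤)
open import Data.Integer.Base as ℤ using (+_)
import Data.Integer.Properties as ℤ
open import Data.Integer.DivMod using (_/ℕ_)
import Data.Rational.Base as ℚ
import Data.Rational.Properties as ℚ
open import Data.Rational.Unnormalised.Base as ℚᵘ using (mkℚᵘ; 1ℚᵘ; *≤*)
import Data.Rational.Unnormalised.Properties as ℚᵘ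
open import Data.Rational.Base using (_+_; _*_; _/_; _≤_; 1ℚ)
open import Data.Bool.Properties using () renaming (_≟_ to _≟ᵇ_)
open import Data.Vec.Base using ([]; _∷_; here; there)
import Data.Vec.Properties as Vec
open import Data.Fin.Base using (Fin; zero; suc)
import Data.Fin.Properties as Fin
open import Data.Fin.Subset
  using (Subset; inside; outside; _∈_; _∉_; _∩_; _∪_; _-_; ⋃; ∣_∣; Empty; Nonempty)
open import Data.Fin.Subset.Properties
  using (∣⊥∣≡0; ∣p∣≤n; x∈p∩q⁺; x∈p∩q⁻; x∈p∪q⁻; ∉⊥; nonempty?; _∈?_;
         p─⊥≡p; p─q⊆p; x∈p∧x≢y⇒x∈p-y)
open import Data.List.Base
  using (List; []; _∷_; _++_; map; length; lookup; concatMap; cartesianProduct)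
open import Data.List.Properties using (length-++; length-map; map-++)
import Data.List.Membership.Propositional as List
open import Data.List.Membership.Propositional.Properties
  using (∈-lookup; ∈-map⁺; ∈-map⁻; ∈-++⁺ˡ; ∈-++⁺ʳ; ∈-++⁻; ∈-concatMap⁺; ∈-concatMap⁻;
         ∈-cartesianProduct⁺; ∈-cartesianProduct⁻; ∈-∃++)
import Data.List.Membership.DecPropositional as DecMembership
open import Data.List.Relation.Unary.All as All using (All; []; _∷_)
import Data.List.Relation.Unary.All.Properties as All
open import Data.List.Relation.Unary.Any as Any using (Any; here; there)
import Data.List.Relation.Unary.Any.Properties as Any
open import Data.List.Relation.Unary.AllPairs using (AllPairs; []; _∷_)
import Data.List.Relation.Unary.AllPairs.Properties as AllPairs
open import Data.List.Relation.Unary.Unique.Propositional using (Unique)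
open import Data.List.Relation.Binary.Permutation.Propositional using (_↭_; ↭⇒↭ₛ; ↭-sym)
open import Data.List.Relation.Binary.Permutation.Propositional.Properties
  using (shift; All-resp-↭; ∈-resp-↭; ↭-length)
import Data.List.Relation.Binary.Permutation.Setoid.Properties as SetoidPermutation
open import Data.Product.Base using (_×_; _,_; ∃; ∃₂; proj₁; proj₂)
open import Data.Sum.Base as Sum using (_⊎_; inj₁; inj₂)
open import Level using (Level)
open import Relation.Unary using (Pred)
open import Relation.Nullary using (yes; no; ¬_; contradiction)
open import Relation.Binary.PropositionalEquality
open import Function.Base using (_∘_)
open import Defs

private
  variable
    a b p q r : Level
    A : Set a
    B : Set b
    n : ℕ

-- Cardinality bounds for predicates

-- Quantifying over duplicate-free lists bounds the number of elements satisfying `P` without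
-- deciding `P` or enumerating its extension.
AtMost : {A : Set a} → Pred A p → ℕ → Set _
AtMost P n = ∀ {xs} → Unique xs → All P xs → length xs ℕ.≤ n

lookup-injective : {xs : List A} → Unique xs → ∀ {i j} → lookup xs i ≡ lookup xs j → i ≡ j
lookup-injective (_ ∷ _) {zero}  {zero}  _  = refl
lookup-injective (x∉ ∷ _) {zero}  {suc j} eq = contradiction eq (All.lookup x∉ (∈-lookup j))
lookup-injective (x∉ ∷ _) {suc i} {zero}  eq = contradiction (sym eq) (All.lookup x∉ (∈-lookup i))
lookup-injective (_ ∷ u) {suc i} {suc j} eq = cong suc (lookup-injective u eq)

-- Pigeonhole: positions in `xs` inject into positions in `ys`. Since `R` is a relation, an element
-- may have several codes; any one of them may be chosen, as no code is shared by two elements.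
atMost-code : {P : Pred A p} (R : A → B → Set r) (ys : List B) →
  (∀ {x} → P x → ∃ λ y → y List.∈ ys × R x y) →
  (∀ {x x′ y} → P x → P x′ → R x y → R x′ y → x ≡ x′) →
  AtMost P (length ys)
atMost-code R ys code decode {xs} uniq all = Fin.injective⇒≤ {f = f} f-injective
  where
  enc : ∀ i → ∃ λ y → y List.∈ ys × R (lookup xs i) y
  enc i = code (All.lookup all (∈-lookup i))
  f : Fin (length xs) → Fin (length ys)
  f i = Any.index (proj₁ (proj₂ (enc i)))
  lookup-index : ∀ i → proj₁ (enc i) ≡ lookup ys (f i)
  lookup-index i = Any.lookup-index (proj₁ (proj₂ (enc i)))
  f-injective : ∀ {i j} → f i ≡ f j → i ≡ j
  f-injective {i} {j} eq = lookup-injective uniq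
    (decode (All.lookup all (∈-lookup i)) (All.lookup all (∈-lookup j))
      (proj₂ (proj₂ (enc i)))
      (subst (R (lookup xs j)) (sym same) (proj₂ (proj₂ (enc j)))))
    where
    same : proj₁ (enc i) ≡ proj₁ (enc j)
    same = trans (lookup-index i) (trans (cong (lookup ys) eq) (sym (lookup-index j)))

-- The clause for arbitrary `S` says that both parts inherit every property of `xs`; with `S` taken
-- as being different from the head, it keeps the parts duplicate-free in the recursion.
split : {A : Set a} {P : Pred A p} {Q : Pred A q} {xs : List A} → Unique xs →
  All (λ x → P x ⊎ Q x) xs →
  ∃₂ λ ys zs → Unique ys × Unique zs × All P ys × All Q zs ×
    (∀ {S : Pred A a} → All S xs → All S ys × All S zs) × length xs ≡ length ys ℕ.+ length zs
split [] [] = [] , [] , [] , [] , [] , [] , (λ _ → [] , []) , refl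
split (x∉ ∷ u) (c ∷ cs) with split u cs
split (x∉ ∷ u) (inj₁ px ∷ cs) | ys , zs , uy , uz , py , qz , sub , eq =
  _ ∷ ys , zs , proj₁ (sub x∉) ∷ uy , uz , px ∷ py , qz ,
  (λ { (s ∷ ss) → s ∷ proj₁ (sub ss) , proj₂ (sub ss) }) , cong suc eq
split (x∉ ∷ u) (inj₂ qx ∷ cs) | ys , zs , uy , uz , py , qz , sub , eq =
  ys , _ ∷ zs , uy , proj₂ (sub x∉) ∷ uz , py , qx ∷ qz ,
  (λ { (s ∷ ss) → proj₁ (sub ss) , s ∷ proj₂ (sub ss) }) ,
  trans (cong suc eq) (sym (ℕ.+-suc _ _))

atMost-⊎ : {P : Pred A p} {Q : Pred A q} {m n : ℕ} → AtMost P m → AtMost Q n →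
  AtMost (λ x → P x ⊎ Q x) (m ℕ.+ n)
atMost-⊎ bp bq u cs with split u cs
... | ys , zs , uy , uz , py , qz , _ , eq =
  ℕ.≤-trans (ℕ.≤-reflexive eq) (ℕ.+-mono-≤ (bp uy py) (bq uz qz))

atMost-⊆ : {P : Pred A p} {Q : Pred A q} {n : ℕ} → (∀ {x} → P x → Q x) → AtMost Q n → AtMost P n
atMost-⊆ P⊆Q bq u ps = bq u (All.map P⊆Q ps)

atMost-Any : {Q : B → Pred A q} {n : ℕ} (is : List B) →
  (∀ {i} → i List.∈ is → AtMost (Q i) n) →
  AtMost (λ x → Any (λ i → Q i x) is) (length is ℕ.* n)
atMost-Any []       bs u []      = z≤n
atMost-Any (i ∷ is) bs u cs =
  atMost-⊎ (bs (here refl)) (atMost-Any is (bs ∘ there)) u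
    (All.map (λ { (here q) → inj₁ q ; (there q) → inj₂ q }) cs)

atMost-∈ : (ys : List A) → AtMost (List._∈ ys) (length ys)
atMost-∈ ys = atMost-code _≡_ ys (λ x∈ → _ , x∈ , refl) (λ { _ _ refl refl → refl })

-- Finite subsets: enumeration, puncturing, disjoint unions

elements : Subset n → List (Fin n)
elements []            = []
elements (inside  ∷ p) = zero ∷ map suc (elements p)
elements (outside ∷ p) = map suc (elements p)

∈-elements⁺ : ∀ {x : Fin n} {p} → x ∈ p → x List.∈ elements p
∈-elements⁺ here = here refl
∈-elements⁺ {p = inside  ∷ p} (there x∈p) = there (∈-map⁺ suc (∈-elements⁺ x∈p))
∈-elements⁺ {p = outside ∷ p} (there x∈p) = ∈-map⁺ suc (∈-elements⁺ x∈p)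

∈-elements⁻ : ∀ {x : Fin n} p → x List.∈ elements p → x ∈ p
∈-elements⁻ (inside  ∷ p) (here refl) = here
∈-elements⁻ (inside  ∷ p) (there x∈) with ∈-map⁻ suc x∈
... | _ , y∈ , refl = there (∈-elements⁻ p y∈)
∈-elements⁻ (outside ∷ p) x∈ with ∈-map⁻ suc x∈
... | _ , y∈ , refl = there (∈-elements⁻ p y∈)

length-elements : (p : Subset n) → length (elements p) ≡ ∣ p ∣
length-elements []            = refl
length-elements (inside  ∷ p) = cong suc (trans (length-map suc (elements p)) (length-elements p))
length-elements (outside ∷ p) = trans (length-map suc (elements p)) (length-elements p)

suc∣p-x∣≡∣p∣ : ∀ {x : Fin n} {p} → x ∈ p → suc ∣ p - x ∣ ≡ ∣ p ∣
suc∣p-x∣≡∣p∣ {p = inside ∷ p}  here        = cong (suc ∘ ∣_∣) (p─⊥≡p p)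
suc∣p-x∣≡∣p∣ {p = inside ∷ p}  (there x∈p) = cong suc (suc∣p-x∣≡∣p∣ x∈p)
suc∣p-x∣≡∣p∣ {p = outside ∷ p} (there x∈p) = suc∣p-x∣≡∣p∣ x∈p

x∈p-y⇒x≢y : ∀ {x y : Fin n} (p : Subset n) → x ∈ p - y → x ≢ y
x∈p-y⇒x≢y (s ∷ p) (there x∈) refl = x∈p-y⇒x≢y p x∈ refl

Disjoint : Subset n → Subset n → Set
Disjoint p q = Empty (p ∩ q)

disjoint-sym : {p q : Subset n} → Disjoint p q → Disjoint q p
disjoint-sym {p = p} {q} d (x , x∈) = let x∈q , x∈p = x∈p∩q⁻ q p x∈ in d (x , x∈p∩q⁺ (x∈p , x∈q))

disjoint-tail : ∀ s t {p q : Subset n} → Disjoint (s ∷ p) (t ∷ q) → Disjoint p q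
disjoint-tail _ _ d (x , x∈) = d (suc x , there x∈)

∣p∪q∣≡∣p∣+∣q∣ : (p q : Subset n) → Disjoint p q → ∣ p ∪ q ∣ ≡ ∣ p ∣ ℕ.+ ∣ q ∣
∣p∪q∣≡∣p∣+∣q∣ []            []            d = refl
∣p∪q∣≡∣p∣+∣q∣ (inside  ∷ p) (inside  ∷ q) d = contradiction (zero , here) d
∣p∪q∣≡∣p∣+∣q∣ (inside  ∷ p) (outside ∷ q) d = cong suc (∣p∪q∣≡∣p∣+∣q∣ p q (disjoint-tail inside outside d))
∣p∪q∣≡∣p∣+∣q∣ (outside ∷ p) (inside  ∷ q) d =
  trans (cong suc (∣p∪q∣≡∣p∣+∣q∣ p q (disjoint-tail outside inside d))) (sym (ℕ.+-suc _ _))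
∣p∪q∣≡∣p∣+∣q∣ (outside ∷ p) (outside ∷ q) d = ∣p∪q∣≡∣p∣+∣q∣ p q (disjoint-tail outside outside d)

∈-⋃⁻ : ∀ {x : Fin n} ps → x ∈ ⋃ ps → Any (x ∈_) ps
∈-⋃⁻ []       x∈ = contradiction x∈ ∉⊥
∈-⋃⁻ (p ∷ ps) x∈ with x∈p∪q⁻ p (⋃ ps) x∈
... | inj₁ x∈p = here x∈p
... | inj₂ x∈⋃ = there (∈-⋃⁻ ps x∈⋃)

∣⋃∣≡sum : {ps : List (Subset n)} → AllPairs Disjoint ps → ∣ ⋃ ps ∣ ≡ sum (map ∣_∣ ps)
∣⋃∣≡sum {n = n} [] = ∣⊥∣≡0 n
∣⋃∣≡sum {ps = p ∷ ps} (d ∷ ds) =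
  trans (∣p∪q∣≡∣p∣+∣q∣ p (⋃ ps) disj) (cong (∣ p ∣ ℕ.+_) (∣⋃∣≡sum ds))
  where
  disj : Disjoint p (⋃ ps)
  disj (x , x∈) = let x∈p , x∈⋃ = x∈p∩q⁻ p (⋃ ps) x∈ in
    let dis , x∈q = All.lookupAny d (∈-⋃⁻ ps x∈⋃) in
    dis (x , x∈p∩q⁺ (x∈p , x∈q))

sum-const : {f : A → ℕ} {c : ℕ} {xs : List A} → All (λ x → f x ≡ c) xs →
  sum (map f xs) ≡ length xs ℕ.* c
sum-const []         = refl
sum-const (eq ∷ eqs) = cong₂ ℕ._+_ eq (sum-const eqs)

-- Pairs of points from different members of a family

-- The point from the earlier member comes first, so for disjoint members each unordered pair is
-- listed only once.
transversals : List (Subset n) → List (Fin n × Fin n)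
transversals []       = []
transversals (C ∷ Cs) = cartesianProduct (elements C) (concatMap elements Cs) ++ transversals Cs

length-cartesianProduct : (xs : List A) (ys : List B) →
  length (cartesianProduct xs ys) ≡ length xs ℕ.* length ys
length-cartesianProduct []       ys = refl
length-cartesianProduct (x ∷ xs) ys = trans (length-++ (map (x ,_) ys))
  (cong₂ ℕ._+_ (length-map (x ,_) ys) (length-cartesianProduct xs ys))

length-concatMap : (f : A → List B) {c : ℕ} {xs : List A} →
  All (λ x → length (f x) ≡ c) xs → length (concatMap f xs) ≡ length xs ℕ.* c
length-concatMap f []                  = refl
length-concatMap f {xs = x ∷ xs} (eq ∷ eqs) =
  trans (length-++ (f x)) (cong₂ ℕ._+_ eq (length-concatMap f eqs))

-- A new member with `k` points forms `k * (l * k)` pairs with the `l` members after it. Doubling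
-- avoids halving `l * (l ∸ 1)`.
2*length-transversals : ∀ {k} {Cs : List (Subset n)} → All (λ C → ∣ C ∣ ≡ k) Cs →
  2 ℕ.* length (transversals Cs) ≡ k ℕ.* k ℕ.* (length Cs ℕ.* (length Cs ℕ.∸ 1))
2*length-transversals {k = k} [] = sym (ℕ.*-zeroʳ (k ℕ.* k))
2*length-transversals {k = k} {C ∷ Cs} (∣C∣ ∷ sizes) = begin
  2 ℕ.* length (cartesianProduct (elements C) (concatMap elements Cs) ++ transversals Cs)
    ≡⟨ cong (2 ℕ.*_) (length-++ (cartesianProduct (elements C) _)) ⟩
  2 ℕ.* (length (cartesianProduct (elements C) (concatMap elements Cs)) ℕ.+ length (transversals Cs))
    ≡⟨ cong (λ h → 2 ℕ.* (h ℕ.+ length (transversals Cs))) first ⟩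
  2 ℕ.* (k ℕ.* (l ℕ.* k) ℕ.+ length (transversals Cs))
    ≡⟨ ℕ.*-distribˡ-+ 2 (k ℕ.* (l ℕ.* k)) _ ⟩
  2 ℕ.* (k ℕ.* (l ℕ.* k)) ℕ.+ 2 ℕ.* length (transversals Cs)
    ≡⟨ cong (2 ℕ.* (k ℕ.* (l ℕ.* k)) ℕ.+_) (2*length-transversals sizes) ⟩
  2 ℕ.* (k ℕ.* (l ℕ.* k)) ℕ.+ k ℕ.* k ℕ.* (l ℕ.* (l ℕ.∸ 1))
    ≡⟨ step l ⟩
  k ℕ.* k ℕ.* (suc l ℕ.* l) ∎
  where
  open ≡-Reasoning
  l = length Cs
  first : length (cartesianProduct (elements C) (concatMap elements Cs)) ≡ k ℕ.* (l ℕ.* k)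
  first = trans (length-cartesianProduct (elements C) _)
    (cong₂ ℕ._*_ (trans (length-elements C) ∣C∣)
      (length-concatMap elements (All.map (λ {C} → trans (length-elements C)) sizes)))
  poly : ∀ k l → 2 ℕ.* (k ℕ.* (suc l ℕ.* k)) ℕ.+ k ℕ.* k ℕ.* (suc l ℕ.* l) ≡ k ℕ.* k ℕ.* (suc (suc l) ℕ.* suc l)
  poly = solve-∀
  poly₀ : ∀ k → 2 ℕ.* (k ℕ.* (0 ℕ.* k)) ℕ.+ k ℕ.* k ℕ.* 0 ≡ k ℕ.* k ℕ.* 0
  poly₀ = solve-∀
  -- The case split removes the truncated `l ∸ 1`, leaving polynomial identities; at `l = 0` its
  -- value is multiplied by zero.
  step : ∀ l → 2 ℕ.* (k ℕ.* (l ℕ.* k)) ℕ.+ k ℕ.* k ℕ.* (l ℕ.* (l ℕ.∸ 1)) ≡ k ℕ.* k ℕ.* (suc l ℕ.* l)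
  step zero    = poly₀ k
  step (suc l) = poly k l

transversals-distinct : {Cs : List (Subset n)} → AllPairs Disjoint Cs →
  ∀ {x y} → (x , y) List.∈ transversals Cs → x ≢ y
transversals-distinct {Cs = C ∷ Cs} (d ∷ ds) xy∈ refl
  with ∈-++⁻ (cartesianProduct (elements C) (concatMap elements Cs)) xy∈
... | inj₂ xx∈ = transversals-distinct ds xx∈ refl
... | inj₁ xx∈ =
  let x∈C , x∈Cs = ∈-cartesianProduct⁻ (elements C) (concatMap elements Cs) xx∈
      dis , x∈C′ = All.lookupAny d (∈-concatMap⁻ elements x∈Cs)
  in dis (_ , x∈p∩q⁺ (∈-elements⁻ C x∈C , ∈-elements⁻ _ x∈C′))

-- How a block meets a family: nowhere, in one member, or across members

Crossing : List (Subset n) → Subset n → Set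
Crossing Cs B = ∃₂ λ x y → (x , y) List.∈ transversals Cs × x ∈ B × y ∈ B

MeetsOnly : List (Subset n) → Subset n → Subset n → Set
MeetsOnly Cs B C = Nonempty (C ∩ B) × (∀ {C′} → C′ List.∈ Cs → Nonempty (C′ ∩ B) → C′ ≡ C)

classify : (Cs : List (Subset n)) (B : Subset n) →
  All (λ C → Disjoint C B) Cs ⊎ Crossing Cs B ⊎ Any (MeetsOnly Cs B) Cs
classify []       B = inj₁ []
classify (C ∷ Cs) B with nonempty? (C ∩ B) | classify Cs B
... | _ | inj₂ (inj₁ (x , y , xy∈ , x∈B , y∈B)) =
  inj₂ (inj₁ (x , y , ∈-++⁺ʳ (cartesianProduct (elements C) _) xy∈ , x∈B , y∈B))
... | no ∅ | inj₁ ∅s = inj₁ (∅ ∷ ∅s)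
... | no ∅ | inj₂ (inj₂ m) = inj₂ (inj₂ (there
  (Any.map (λ (ne , only) → ne , λ { (here refl) ne′ → contradiction ne′ ∅ ; (there C′∈) → only C′∈ }) m)))
... | yes ne | inj₁ ∅s = inj₂ (inj₂ (here (ne ,
  λ { (here refl) _ → refl ; (there C′∈) ne′ → contradiction ne′ (All.lookup ∅s C′∈) })))
-- `B` meets both `C` and a later member `C′`, so one point from each gives a crossing pair.
... | yes (x , x∈) | inj₂ (inj₂ m) with List.find m
...   | C′ , C′∈ , (y , y∈) , _ =
  let x∈C , x∈B = x∈p∩q⁻ C B x∈ ; y∈C′ , y∈B = x∈p∩q⁻ C′ B y∈ in
  inj₂ (inj₁ (x , y , ∈-++⁺ˡ (∈-cartesianProduct⁺ (∈-elements⁺ x∈C)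
    (∈-concatMap⁺ elements (Any.map (λ { refl → ∈-elements⁺ y∈C′ }) C′∈))) , x∈B , y∈B))

allPairs-map : {P : Pred A p} {R : A → A → Set q} {S : A → A → Set r} {xs : List A} →
  (∀ {x y} → P x → P y → R x y → S x y) → All P xs → AllPairs R xs → AllPairs S xs
allPairs-map f []        []         = []
allPairs-map f (px ∷ ps) (rx ∷ rs) =
  All.zipWith (λ (py , r) → f px py r) (ps , rx) ∷ allPairs-map f ps rs

-- Blocks private to a member of a partial parallel class

module _ {v k : ℕ} (D : Packing v k) where
  open Packing D using (uniform; packing)

  common-point-unique : ∀ {A B x y} → A List.∈ blocks D → B List.∈ blocks D → A ≢ B →
    x ∈ A → y ∈ A → x ∈ B → y ∈ B → x ≡ y
  common-point-unique {x = x} {y} A∈ B∈ A≢B xA yA xB yB with x Fin.≟ y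
  ... | yes x≡y = x≡y
  ... | no  x≢y = contradiction (packing x≢y A∈ B∈ xA yA xB yB) A≢B

  module _ {P : List (Subset v)} (ppc : IsPPC D P) where
    open IsPPC ppc

    -- `distinct` excludes `C` itself, which by disjointness of `P` meets no other member either.
    record Private (C B : Subset v) : Set where
      field
        block    : B List.∈ blocks D
        distinct : B ≢ C
        meets    : Nonempty (C ∩ B)
        only     : ∀ {C′} → C′ List.∈ P → Nonempty (C′ ∩ B) → C′ ≡ C
    open Private

    PrivateAt : Subset v → Fin v → Subset v → Set
    PrivateAt C x B = Private C B × x ∈ C × x ∈ B

    privateAt : ∀ {C B} → Private C B → ∃ λ x → PrivateAt C x B
    privateAt {C} {B} pr = let x , x∈ = meets pr in x , pr , x∈p∩q⁻ C B x∈

    private-unique-point : ∀ {C B x y} → C List.∈ P → PrivateAt C x B → y ∈ C → y ∈ B → x ≡ y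
    private-unique-point C∈ (pr , x∈C , x∈B) y∈C y∈B =
      common-point-unique (block pr) (All.lookup isBlock C∈) (distinct pr) x∈B y∈B x∈C y∈C

    -- Removing `C` from `P` and adding `B` and `B′` gains one block: private blocks of `C` miss
    -- every other member.
    exchange : ∀ {C B B′} → C List.∈ P → Private C B → Private C B′ → Disjoint B B′ →
      HasPPC D (suc (length P))
    exchange {C} {B} {B′} C∈ pr pr′ dis with ∈-∃++ C∈
    ... | Q₁ , Q₂ , refl = B ∷ B′ ∷ Q , record
      { unique   = (B≢B′ ∷ fresh pr) ∷ fresh pr′ ∷ tailUnique
      ; isBlock  = block pr ∷ block pr′ ∷ All.tail (All-resp-↭ P↭C∷Q isBlock)
      ; disjoint = (dis ∷ apart pr) ∷ apart pr′ ∷ tailDisjoint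
      } , cong suc (sym (↭-length P↭C∷Q))
      where
      Q = Q₁ ++ Q₂
      P↭C∷Q : P ↭ C ∷ Q
      P↭C∷Q = shift C Q₁ Q₂
      module SP = SetoidPermutation (setoid (Subset v))
      -- Being distinct and being disjoint are symmetric relations, so both survive moving `C` to
      -- the front.
      C∷Q-unique : Unique (C ∷ Q)
      C∷Q-unique = SP.AllPairs-resp-↭ ≢-sym (resp₂ _≢_) (↭⇒↭ₛ P↭C∷Q) unique
      C∷Q-disjoint : AllPairs Disjoint (C ∷ Q)
      C∷Q-disjoint = SP.AllPairs-resp-↭ disjoint-sym (resp₂ Disjoint) (↭⇒↭ₛ P↭C∷Q) disjoint
      tailUnique : Unique Q
      tailUnique with _ ∷ u ← C∷Q-unique = u
      tailDisjoint : AllPairs Disjoint Q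
      tailDisjoint with _ ∷ d ← C∷Q-disjoint = d
      Q⊆P : ∀ {C′} → C′ List.∈ Q → C′ List.∈ P
      Q⊆P C′∈ = ∈-resp-↭ (↭-sym P↭C∷Q) (there C′∈)
      C∉Q : ∀ {C′} → C′ List.∈ Q → C′ ≢ C
      C∉Q C′∈ with C≢ ∷ _ ← C∷Q-unique = ≢-sym (All.lookup C≢ C′∈)
      apart : ∀ {A} → Private C A → All (Disjoint A) Q
      apart pr = All.tabulate λ C′∈ → disjoint-sym λ ne → C∉Q C′∈ (only pr (Q⊆P C′∈) ne)
      fresh : ∀ {A} → Private C A → All (A ≢_) Q
      -- If `A` were in `Q`, it would be a member of `P` meeting itself, so `only` would force it to
      -- be `C`.
      fresh {A} pr = All.tabulate λ { C′∈ refl →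
        let _ , _ , x∈A = proj₂ (privateAt pr) in
        distinct pr (only pr (Q⊆P C′∈) (_ , x∈p∩q⁺ (x∈A , x∈A))) }
      B≢B′ : B ≢ B′
      B≢B′ refl = let _ , _ , x∈B = proj₂ (privateAt pr) in dis (_ , x∈p∩q⁺ (x∈B , x∈B))

    -- Distinct blocks through `x` share no other point, so once `x` is removed they are pairwise
    -- disjoint, and also disjoint from all of `P`. The sizes then add up to at most `v`.
    concurrent-bound : ∀ {C x Bs} → C List.∈ P → Unique Bs → All (PrivateAt C x) Bs →
      length P ℕ.* k ℕ.+ length Bs ℕ.* (k ℕ.∸ 1) ℕ.≤ v
    concurrent-bound {C} {x} {Bs} C∈ uniq all =
      subst (ℕ._≤ v) (trans (∣⋃∣≡sum family-disjoint) sizes) (∣p∣≤n (⋃ family))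
      where
      family = P ++ map (_- x) Bs
      sizes : sum (map ∣_∣ family) ≡ length P ℕ.* k ℕ.+ length Bs ℕ.* (k ℕ.∸ 1)
      sizes = begin
        sum (map ∣_∣ family)
          ≡⟨ cong sum (map-++ ∣_∣ P _) ⟩
        sum (map ∣_∣ P ++ map ∣_∣ (map (_- x) Bs))
          ≡⟨ sum-++ (map ∣_∣ P) _ ⟩
        sum (map ∣_∣ P) ℕ.+ sum (map ∣_∣ (map (_- x) Bs))
          ≡⟨ cong₂ ℕ._+_ (sum-const (All.map uniform isBlock))
               (sum-const (All.map⁺ (All.map punctured all))) ⟩
        length P ℕ.* k ℕ.+ length (map (_- x) Bs) ℕ.* (k ℕ.∸ 1)
          ≡⟨ cong (λ l → length P ℕ.* k ℕ.+ l ℕ.* (k ℕ.∸ 1)) (length-map (_- x) Bs) ⟩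
        length P ℕ.* k ℕ.+ length Bs ℕ.* (k ℕ.∸ 1) ∎
        where
        open ≡-Reasoning
        punctured : ∀ {B} → PrivateAt C x B → ∣ B - x ∣ ≡ k ℕ.∸ 1
        punctured (pr , _ , x∈B) =
          cong (ℕ._∸ 1) (trans (suc∣p-x∣≡∣p∣ x∈B) (uniform (block pr)))
      punctured-disjoint : ∀ {A B} → PrivateAt C x A → PrivateAt C x B → A ≢ B →
        Disjoint (A - x) (B - x)
      punctured-disjoint {A} {B} (prA , _ , x∈A) (prB , _ , x∈B) A≢B (y , y∈) =
        let y∈A-x , y∈B-x = x∈p∩q⁻ (A - x) (B - x) y∈ in
        x∈p-y⇒x≢y A y∈A-x (common-point-unique (block prA) (block prB) A≢B
          (p─q⊆p A _ y∈A-x) x∈A (p─q⊆p B _ y∈B-x) x∈B)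
      P-apart : ∀ {C′ B} → C′ List.∈ P → PrivateAt C x B → Disjoint C′ (B - x)
      -- A common point makes `C′` equal to `C`; but `B` meets `C` only in `x`, which is missing
      -- from `B - x`.
      P-apart {C′} {B} C′∈ pat@(pr , _) (y , y∈)
        with y∈C′ , y∈B-x ← x∈p∩q⁻ C′ (B - x) y∈
        with refl ← only pr C′∈ (y , x∈p∩q⁺ (y∈C′ , p─q⊆p B _ y∈B-x)) =
        x∈p-y⇒x≢y B y∈B-x (sym (private-unique-point C∈ pat y∈C′ (p─q⊆p B _ y∈B-x)))
      family-disjoint : AllPairs Disjoint family
      family-disjoint = AllPairs.++⁺ disjoint
        (AllPairs.map⁺ (allPairs-map punctured-disjoint all uniq))
        (All.tabulate λ C′∈ → All.map⁺ (All.map (P-apart C′∈) all))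

    -- Counting blocks when the class is maximum

    module _ (maximum : ¬ HasPPC D (suc (length P))) where

      -- Disjoint `B` and `B′` could be exchanged for `C`. A common point inside `C` would equal
      -- both `x` and `x′`.
      private-meet : ∀ {C x x′ B B′} → C List.∈ P → PrivateAt C x B → PrivateAt C x′ B′ →
        x ≢ x′ → ∃ λ z → z ∈ B × z ∈ B′ × z ∉ C
      private-meet {C} {B = B} {B′} C∈ pat pat′ x≢x′ with nonempty? (B ∩ B′)
      ... | no  ∅ = contradiction (exchange C∈ (proj₁ pat) (proj₁ pat′) ∅) maximum
      ... | yes (z , z∈) =
        let z∈B , z∈B′ = x∈p∩q⁻ B B′ z∈ in
        z , z∈B , z∈B′ , λ z∈C → x≢x′
          (trans (private-unique-point C∈ pat z∈C z∈B)
            (sym (private-unique-point C∈ pat′ z∈C z∈B′)))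

      -- A block at `x` is coded by a point `z` outside `C` that it shares with `E`. As `x′` lies in
      -- `C`, only `k ∸ 1` points of `E` can occur, and the two points `x` and `z` determine the
      -- block.
      pencil-bound : ∀ {C x x′ E} → C List.∈ P → PrivateAt C x′ E → x ≢ x′ →
        AtMost (PrivateAt C x) (k ℕ.∸ 1)
      pencil-bound {C} {x} {x′} {E} C∈ patE@(prE , x′∈C , x′∈E) x≢x′ =
        subst (AtMost (PrivateAt C x)) size
          (atMost-code (λ B z → z ∈ B × z ∉ C) (elements (E - x′)) code decode)
        where
        size : length (elements (E - x′)) ≡ k ℕ.∸ 1
        size = trans (length-elements (E - x′))
          (cong (ℕ._∸ 1) (trans (suc∣p-x∣≡∣p∣ x′∈E) (uniform (block prE))))
        code : ∀ {B} → PrivateAt C x B → ∃ λ z → z List.∈ elements (E - x′) × z ∈ B × z ∉ C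
        code pat with z , z∈B , z∈E , z∉C ← private-meet C∈ pat patE x≢x′ =
          z , ∈-elements⁺ (x∈p∧x≢y⇒x∈p-y z∈E λ { refl → z∉C x′∈C }) , z∈B , z∉C
        decode : ∀ {B B′ z} → PrivateAt C x B → PrivateAt C x B′ →
          z ∈ B × z ∉ C → z ∈ B′ × z ∉ C → B ≡ B′
        decode (pr , x∈C , x∈B) (pr′ , _ , x∈B′) (z∈B , z∉C) (z∈B′ , _) =
          packing (λ { refl → z∉C x∈C }) (block pr) (block pr′) x∈B z∈B x∈B′ z∈B′

      -- Each of the `k` points of `C` differs from `x₁` or from `x₂`, so `E₁` or `E₂` bounds its
      -- pencil.
      nonconcurrent-bound : ∀ {C x₁ x₂ E₁ E₂} → C List.∈ P →
        PrivateAt C x₁ E₁ → PrivateAt C x₂ E₂ → x₁ ≢ x₂ →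
        AtMost (Private C) (k ℕ.* (k ℕ.∸ 1))
      nonconcurrent-bound {C} {x₁} {x₂} C∈ pat₁ pat₂ x₁≢x₂ =
        subst (λ l → AtMost (Private C) (l ℕ.* (k ℕ.∸ 1)))
          (trans (length-elements C) (uniform (All.lookup isBlock C∈)))
          (atMost-⊆ (λ pr → let _ , pat@(_ , x∈C , _) = privateAt pr in
              Any.map (λ { refl → pat }) (∈-elements⁺ x∈C))
            (atMost-Any (elements C) (λ {x} _ → pencil x)))
        where
        pencil : ∀ x → AtMost (PrivateAt C x) (k ℕ.∸ 1)
        pencil x with x Fin.≟ x₁
        ... | yes refl = pencil-bound C∈ pat₂ x₁≢x₂
        ... | no x≢x₁  = pencil-bound C∈ pat₁ x≢x₁

      -- `M` stands for the maximum in the theorem. The second hypothesis states the floor bound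
      -- without division.
      private-bound : ∀ {C M} → C List.∈ P → k ℕ.* (k ℕ.∸ 1) ℕ.≤ M →
        (∀ t → length P ℕ.* k ℕ.+ t ℕ.* (k ℕ.∸ 1) ℕ.≤ v → t ℕ.≤ M) →
        AtMost (Private C) M
      private-bound C∈ small star [] [] = z≤n
      private-bound {C} C∈ small star {E ∷ Bs} uniq all@(pr ∷ prs)
        with x , pat@(_ , x∈C , _) ← privateAt pr
        with All.all? (x ∈?_) (E ∷ Bs)
      ... | yes x∈ = star _ (concurrent-bound C∈ uniq
              (All.zipWith (λ (pr , x∈B) → pr , x∈C , x∈B) (all , x∈)))
      -- Some block `E₂` misses `x`, so the point where it meets `C` differs from `x`.
      ... | no ¬x∈ with E₂ , E₂∈ , x∉E₂ ← List.find (All.¬All⇒Any¬ (x ∈?_) _ ¬x∈)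
                   with x₂ , pat₂@(_ , _ , x₂∈E₂) ← privateAt (All.lookup all E₂∈) =
        ℕ.≤-trans (nonconcurrent-bound C∈ pat pat₂ (λ { refl → x∉E₂ x₂∈E₂ }) uniq all) small

      block-cases : ∀ {B} → B List.∈ blocks D →
        B List.∈ P ⊎ Crossing P B ⊎ Any (λ C → Private C B) P
      block-cases {B} B∈ with DecMembership._∈?_ (Vec.≡-dec _≟ᵇ_) B P | classify P B
      ... | yes B∈P | _ = inj₁ B∈P
      ... | no  B∉P | inj₂ (inj₁ cr) = inj₂ (inj₁ cr)
      ... | no  B∉P | inj₂ (inj₂ m)  with C , C∈ , ne , only ← List.find m =
        inj₂ (inj₂ (Any.map (λ { refl → record
          { block = B∈ ; distinct = λ { refl → B∉P C∈ } ; meets = ne ; only = only } }) C∈))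
      -- A block disjoint from all members would extend `P`.
      ... | no  B∉P | inj₁ ∅s = contradiction (B ∷ P , record
          { unique   = All.¬Any⇒All¬ P B∉P ∷ unique
          ; isBlock  = B∈ ∷ isBlock
          ; disjoint = All.map disjoint-sym ∅s ∷ disjoint
          } , refl) maximum

      -- A crossing block is coded by a transversal pair inside it. The code records `x ≢ y`, so
      -- that the packing property recovers the block.
      crossing-bound : AtMost (λ B → B List.∈ blocks D × Crossing P B) (length (transversals P))
      crossing-bound = atMost-code
        (λ B (x , y) → x ≢ y × x ∈ B × y ∈ B) (transversals P)
        (λ (_ , x , y , xy∈ , x∈B , y∈B) →
          (x , y) , xy∈ , transversals-distinct disjoint xy∈ , x∈B , y∈B)
        (λ (B∈ , _) (B′∈ , _) (x≢y , x∈B , y∈B) (_ , x∈B′ , y∈B′) →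
          packing x≢y B∈ B′∈ x∈B y∈B x∈B′ y∈B′)

      blocks-bound : ∀ {M} → k ℕ.* (k ℕ.∸ 1) ℕ.≤ M →
        (∀ t → length P ℕ.* k ℕ.+ t ℕ.* (k ℕ.∸ 1) ℕ.≤ v → t ℕ.≤ M) →
        #blocks D ℕ.≤ length P ℕ.+ (length (transversals P) ℕ.+ length P ℕ.* M)
      blocks-bound small star =
        atMost-⊎ (atMost-∈ P) (atMost-⊎ crossing-bound
          (atMost-Any P (λ C∈ → private-bound C∈ small star)))
          (Packing.unique D)
          (All.tabulate λ B∈ → Sum.map₂ (Sum.map₁ (B∈ ,_)) (block-cases B∈))

-- From counting to the rational inequality

-- The hypothesis forces `k * ρ ≤ v`, so the integer difference is a natural number and the quotient
-- is ordinary division, which is monotone.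
⌊[v-kρ]/[k-1]⌋-greatest : ∀ {ρ v k} (2≤k : 2 ℕ.≤ k) t →
  ρ ℕ.* k ℕ.+ t ℕ.* (k ℕ.∸ 1) ℕ.≤ v → + t ℤ.≤ ⌊[v-kρ]/[k-1]⌋ ρ v k 2≤k
⌊[v-kρ]/[k-1]⌋-greatest {ρ} {v} {k} 2≤k t bound = begin
  + t                                          ≡⟨ cong +_ (m*n/n≡m t (k ℕ.∸ 1)) ⟨
  + (t ℕ.* (k ℕ.∸ 1) ℕ./ (k ℕ.∸ 1))            ≤⟨ ℤ.+≤+ (/-monoˡ-≤ (k ℕ.∸ 1) t≤) ⟩
  + (v ℕ.∸ k ℕ.* ρ) /ℕ (k ℕ.∸ 1)               ≡⟨ cong (_/ℕ (k ℕ.∸ 1)) (ℤ.⊖-≥ kρ≤v) ⟨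
  (v ℤ.⊖ k ℕ.* ρ) /ℕ (k ℕ.∸ 1)                 ≡⟨ cong (_/ℕ (k ℕ.∸ 1)) (ℤ.m-n≡m⊖n v (k ℕ.* ρ)) ⟨
  (+ v ℤ.- + (k ℕ.* ρ)) /ℕ (k ℕ.∸ 1)           ∎
  where
  open ℤ.≤-Reasoning
  instance nonZero = k∸1-nonZero 2≤k
  bound′ : k ℕ.* ρ ℕ.+ t ℕ.* (k ℕ.∸ 1) ℕ.≤ v
  bound′ = subst (λ h → h ℕ.+ t ℕ.* (k ℕ.∸ 1) ℕ.≤ v) (ℕ.*-comm ρ k) bound
  kρ≤v : k ℕ.* ρ ℕ.≤ v
  kρ≤v = ℕ.m+n≤o⇒m≤o _ bound′
  t≤ : t ℕ.* (k ℕ.∸ 1) ℕ.≤ v ℕ.∸ k ℕ.* ρ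
  t≤ = ℕ.m+n≤o⇒m≤o∸n _ (subst (ℕ._≤ v) (ℕ.+-comm (k ℕ.* ρ) _) bound′)

-- Clears the denominator 2. In unnormalised rationals no common factors are cancelled, so the
-- numerator stays an explicit polynomial.
fromℕ-≤-bracket : ∀ β ρ a M → β ℕ.* 2 ℕ.≤ ρ ℕ.* (a ℕ.+ 2 ℕ.+ 2 ℕ.* M) →
  fromℕ β ≤ fromℕ ρ * ((+ a) / 2 + 1ℚ + fromℤ (+ M))
fromℕ-≤-bracket β ρ a M bound = ℚ.toℚᵘ-cancel-≤ (begin
  ℚ.toℚᵘ (fromℕ β)                                    ≃⟨ ℚ.toℚᵘ-fromℚᵘ (mkℚᵘ (+ β) 0) ⟩
  mkℚᵘ (+ β) 0                                        ≤⟨ *≤* integral ⟩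
  mkℚᵘ (+ ρ) 0 ℚᵘ.* bracketᵘ                          ≃⟨ homo ⟨
  ℚ.toℚᵘ (fromℕ ρ * ((+ a) / 2 + 1ℚ + fromℤ (+ M)))   ∎)
  where
  open ℚᵘ.≤-Reasoning
  -- The second argument of `mkℚᵘ` is the denominator minus one: the first summand is a/2, the last
  -- is `M`.
  bracketᵘ = mkℚᵘ (+ a) 1 ℚᵘ.+ 1ℚᵘ ℚᵘ.+ mkℚᵘ (+ M) 0
  numerator : (+ a ℤ.* + 1 ℤ.+ + 2) ℤ.* + 1 ℤ.+ + M ℤ.* + 2 ≡ + (a ℕ.+ 2 ℕ.+ 2 ℕ.* M)
  numerator rewrite ℤ.*-identityʳ (+ a) | ℤ.*-identityʳ (+ (a ℕ.+ 2)) | sym (ℤ.pos-* M 2) | ℕ.*-comm M 2 = refl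
  integral : + β ℤ.* + 2 ℤ.≤ + ρ ℤ.* ((+ a ℤ.* + 1 ℤ.+ + 2) ℤ.* + 1 ℤ.+ + M ℤ.* + 2) ℤ.* + 1
  integral = subst₂ ℤ._≤_ (ℤ.pos-* β 2)
    (trans (ℤ.pos-* ρ _) (trans (cong (+ ρ ℤ.*_) (sym numerator)) (sym (ℤ.*-identityʳ _))))
    (ℤ.+≤+ bound)
  homo : ℚ.toℚᵘ (fromℕ ρ * ((+ a) / 2 + 1ℚ + fromℤ (+ M))) ℚᵘ.≃ mkℚᵘ (+ ρ) 0 ℚᵘ.* bracketᵘ
  homo = ℚᵘ.≃-trans (ℚ.toℚᵘ-homo-* (fromℕ ρ) _) (ℚᵘ.*-cong (ℚ.toℚᵘ-fromℚᵘ (mkℚᵘ (+ ρ) 0))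
    (ℚᵘ.≃-trans (ℚ.toℚᵘ-homo-+ ((+ a) / 2 + 1ℚ) _) (ℚᵘ.+-cong
      (ℚᵘ.≃-trans (ℚ.toℚᵘ-homo-+ ((+ a) / 2) 1ℚ)
        (ℚᵘ.+-congˡ 1ℚᵘ (ℚ.toℚᵘ-fromℚᵘ (mkℚᵘ (+ a) 1))))
      (ℚ.toℚᵘ-fromℚᵘ (mkℚᵘ (+ M) 0)))))

theorem5p4 : (ρ v k β : ℕ) (2≤k : 2 ℕ.≤ k) → k ℕ.≤ v → 1 ℕ.≤ ρ →
    IsBeta ρ v k β →
    fromℕ β ≤ fromℕ ρ * ((+ (k ℕ.^ 2 ℕ.* (ρ ℕ.∸ 1))) / 2 + 1ℚ + fromℤ (+ (k ℕ.* (k ℕ.∸ 1)) ℤ.⊔ ⌊[v-kρ]/[k-1]⌋ ρ v k 2≤k))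
theorem5p4 ρ v k β 2≤k _ _ isBeta
  with D , ((P , ppc , refl) , maximum) , refl ← IsBeta.attained isBeta =
  subst (λ i → fromℕ β ≤ fromℕ ρ * ((+ c) / 2 + 1ℚ + fromℤ i)) +M≡max
    (fromℕ-≤-bracket β ρ c M doubled)
  where
  c   = k ℕ.^ 2 ℕ.* (ρ ℕ.∸ 1)
  max = + (k ℕ.* (k ℕ.∸ 1)) ℤ.⊔ ⌊[v-kρ]/[k-1]⌋ ρ v k 2≤k
  -- The maximum is at least `k * (k ∸ 1)`, hence nonnegative, so taking the absolute value only
  -- turns it into a natural number.
  M   = ℤ.∣ max ∣
  t   = length (transversals P)
  small : + (k ℕ.* (k ℕ.∸ 1)) ℤ.≤ max
  small = ℤ.i≤i⊔j _ _
  +M≡max : + M ≡ max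
  +M≡max = ℤ.0≤i⇒+∣i∣≡i (ℤ.≤-trans (ℤ.+≤+ z≤n) small)
  ≤M : ∀ {n} → + n ℤ.≤ max → n ℕ.≤ M
  ≤M n≤max = ℤ.drop‿+≤+ (subst (_ ℤ.≤_) (sym +M≡max) n≤max)
  bound : β ℕ.≤ ρ ℕ.+ (t ℕ.+ ρ ℕ.* M)
  bound = blocks-bound D ppc maximum (≤M small)
    (λ n n≤ → ≤M (ℤ.≤-trans (⌊[v-kρ]/[k-1]⌋-greatest {ρ} 2≤k n n≤) (ℤ.i≤j⊔i _ _)))
  collect : ∀ ρ t M → (ρ ℕ.+ (t ℕ.+ ρ ℕ.* M)) ℕ.* 2 ≡ 2 ℕ.* t ℕ.+ ρ ℕ.* (2 ℕ.+ 2 ℕ.* M)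
  collect = solve-∀
  -- `k * (k * 1)` is the form to which `k ^ 2` unfolds, and `r` stands for `ρ ∸ 1`.
  expand : ∀ k ρ r M → k ℕ.* k ℕ.* (ρ ℕ.* r) ℕ.+ ρ ℕ.* (2 ℕ.+ 2 ℕ.* M) ≡
    ρ ℕ.* (k ℕ.* (k ℕ.* 1) ℕ.* r ℕ.+ 2 ℕ.+ 2 ℕ.* M)
  expand = solve-∀
  doubled : β ℕ.* 2 ℕ.≤ ρ ℕ.* (c ℕ.+ 2 ℕ.+ 2 ℕ.* M)
  doubled = begin
    β ℕ.* 2                                                     ≤⟨ ℕ.*-monoˡ-≤ 2 bound ⟩
    (ρ ℕ.+ (t ℕ.+ ρ ℕ.* M)) ℕ.* 2                               ≡⟨ collect ρ t M ⟩
    2 ℕ.* t ℕ.+ ρ ℕ.* (2 ℕ.+ 2 ℕ.* M)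
      ≡⟨ cong (ℕ._+ ρ ℕ.* (2 ℕ.+ 2 ℕ.* M))
           (2*length-transversals (All.map (Packing.uniform D) (IsPPC.isBlock ppc))) ⟩
    k ℕ.* k ℕ.* (ρ ℕ.* (ρ ℕ.∸ 1)) ℕ.+ ρ ℕ.* (2 ℕ.+ 2 ℕ.* M)     ≡⟨ expand k ρ (ρ ℕ.∸ 1) M ⟩
    ρ ℕ.* (c ℕ.+ 2 ℕ.+ 2 ℕ.* M)                                 ∎
    where open ℕ.≤-Reasoning
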